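{- For every positive integer $n$, the number of circular permutations of $[n]=\{1,2,\ldots,n\}$ that avoid the pattern $1234$ equals $2^{n}+1-2n-\binom{n}{3}$.
   Context: A circular permutation of $[n]$ is an arrangement of $1,2,\ldots,n$ clockwise around a circle, two arrangements being identified if they differ by a rotation. Equivalently, it can be represented uniquely as a linear permutation $\pi_1\pi_2\cdots\pi_n$ of $[n]$ with $\pi_n=n$, whose rotations all represent the same circular permutation. The reduced form of a sequence of distinct positive integers is obtained by replacing its smallest entry by $1$, its next smallest by $2$, and so on; a pattern is such a reduced form. An occurrence of a pattern $\tau$ of length $m$ in a circular permutation $\pi$ is a sequence of $m$ letters of $\pi$ read in clockwise order and lying within one revolution (i.e., a subsequence of some rotation of the linear representation) whose reduced form is $\tau$; $\pi$ avoids $\tau$ if it has no occurrence of $\tau$. Here $\binom{n}{3}=0$ for $n<3$. -}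

module Defs where

open import Data.Fin.Base using (Fin)
open import Data.List.Base
  using (List; []; _∷_; _++_; applyUpTo; filter; length; map)
open import Data.List.Properties using (++-assoc; ++-identityʳ; ∷-injective)
open import Data.List.Relation.Binary.Permutation.Propositional using (_↭_)
open import Data.List.Relation.Binary.Sublist.Propositional using (_⊆_)
open import Data.Nat.Base using (ℕ; suc)
open import Data.Nat.Properties using (_<?_)
open import Data.Product.Base using (Σ; ∃-syntax; _×_; _,_; proj₁)
open import Data.Sum.Base using (_⊎_; inj₁; inj₂)
open import Function.Bundles using (Inverse)
open import Level using (Level; 0ℓ)
open import Relation.Binary.Bundles using (Setoid)
import Relation.Binary.Construct.On as On
open import Relation.Binary.PropositionalEquality
  using (_≡_; refl; sym; trans; cong)
import Relation.Binary.PropositionalEquality.Properties as ≡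
open import Relation.Nullary.Negation.Core using (¬_)

private
  variable
    a c ℓ : Level
    A : Set a

infix 4 _≈ʳ_

_≈ʳ_ : {A : Set a} → List A → List A → Set a
xs ≈ʳ ys = ∃[ us ] ∃[ vs ] (xs ≡ us ++ vs × ys ≡ vs ++ us)

≈ʳ-refl : {xs : List A} → xs ≈ʳ xs
≈ʳ-refl {xs = xs} = [] , xs , refl , sym (++-identityʳ xs)

≈ʳ-sym : {xs ys : List A} → xs ≈ʳ ys → ys ≈ʳ xs
≈ʳ-sym (us , vs , p , q) = vs , us , q , p

++-split : (as {bs} cs {ds} : List A) → as ++ bs ≡ cs ++ ds →
           (∃[ ws ] (cs ≡ as ++ ws × bs ≡ ws ++ ds)) ⊎
           (∃[ ws ] (as ≡ cs ++ ws × ds ≡ ws ++ bs))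
++-split []       cs       eq = inj₁ (cs , refl , eq)
++-split (x ∷ as) []       eq = inj₂ (x ∷ as , refl , sym eq)
++-split (x ∷ as) (y ∷ cs) eq with ∷-injective eq
... | refl , eq′ with ++-split as cs eq′
...   | inj₁ (ws , p , q) = inj₁ (ws , cong (x ∷_) p , q)
...   | inj₂ (ws , p , q) = inj₂ (ws , cong (x ∷_) p , q)

≈ʳ-trans : {xs ys zs : List A} → xs ≈ʳ ys → ys ≈ʳ zs → xs ≈ʳ zs
≈ʳ-trans (us , vs , refl , q) (us′ , vs′ , p′ , refl)
  with ++-split vs us′ (trans (sym q) p′)
... | inj₁ (ws , refl , refl) =
  ws , vs′ ++ vs , ++-assoc ws vs′ vs , sym (++-assoc vs′ vs ws)
... | inj₂ (ws , refl , refl) =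
  us ++ us′ , ws , sym (++-assoc us us′ ws) , ++-assoc ws us us′

rotationSetoid : Set a → Setoid a a
rotationSetoid A = record
  { Carrier       = List A
  ; _≈_           = _≈ʳ_
  ; isEquivalence = record { refl = ≈ʳ-refl ; sym = ≈ʳ-sym ; trans = ≈ʳ-trans }
  }

LinearPermutation : ℕ → Set
LinearPermutation n = Σ (List ℕ) (_↭ applyUpTo suc n)

-- Equality only compares the words, up to rotation; the ↭ proofs are ignored.
CircularPermutation : ℕ → Setoid 0ℓ 0ℓ
CircularPermutation n = On.setoid {B = LinearPermutation n} (rotationSetoid ℕ) proj₁

-- Each entry is replaced by its rank among the entries, counted from 1.
-- This is the reduced form when the entries are distinct.
reduce : List ℕ → List ℕ
reduce xs = map (λ x → suc (length (filter (_<? x) xs))) xs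

Occurrence : (τ xs : List ℕ) → Set
Occurrence τ xs = ∃[ ys ] ∃[ ws ] (xs ≈ʳ ys × ws ⊆ ys × reduce ws ≡ τ)

Avoids : (τ xs : List ℕ) → Set
Avoids τ xs = ¬ Occurrence τ xs

Avoiders : (n : ℕ) (τ : List ℕ) → Setoid 0ℓ 0ℓ
Avoiders n τ = On.setoid
  {B = Σ (LinearPermutation n) (λ π → Avoids τ (proj₁ π))}
  (CircularPermutation n) proj₁

HasCardinality : Setoid c ℓ → ℕ → Set _
HasCardinality S k = Inverse S (≡.setoid (Fin k))

{-# OPTIONS --safe #-}
module Submission where

-- Rotate a circular permutation of [m + 1] so that it reads 1 w. It avoids 1234
-- if and only if w avoids 123 and 3412. Such words w grow by inserting a new
-- maximum between as and bs, which is allowed exactly when as is decreasing and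
-- bs has no ascent whose top is below an entry of as. If the maximum is inserted
-- after a nonempty as, the allowed positions of the new word are the old ones up
-- to that point; if it is inserted in front, they are one more than the positions
-- splitting the old word into two decreasing words. A word that is not decreasing
-- has at most one such splitting, so the number of allowed positions and the
-- existence of a splitting determine the generating tree, and the sizes of its
-- levels follow from Pascal-type recurrences.

open import Defs
open import Data.Empty using (⊥-elim)
open import Data.Fin.Base using (Fin; zero; suc)
open import Data.List.Base
  using (List; []; _∷_; _++_; [_]; applyDownFrom; applyUpTo; concatMap; filter; length; lookup; map)
open import Data.List.Membership.Propositional using (_∈_; lose)
open import Data.List.Membership.Propositional.Properties
  using (∈-++⁺ˡ; ∈-++⁺ʳ; ∈-++⁻; ∈-concatMap⁺; ∈-lookup; ∈-map⁺; ∈-map⁻; ∈-∃++)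
open import Data.List.Properties
  using (++-assoc; ++-identityʳ; ∷-injective; applyUpTo-∷ʳ; filter-accept; filter-reject;
         length-++-≤ˡ; length-applyDownFrom; map-++; map-cong; map-∘)
open import Data.List.Relation.Binary.Permutation.Propositional
  using (_↭_; prep; ↭-refl; ↭-reflexive; ↭-sym; ↭-trans)
open import Data.List.Relation.Binary.Permutation.Propositional.Properties
  using (++-comm; All-resp-↭; drop-mid; shift; ∈-resp-↭; ∷↭∷ʳ; ↭-empty-inv)
open import Data.List.Relation.Binary.Sublist.Propositional
  using (_⊆_; []; _∷_; _∷ʳ_; from∈; minimum; to∈; ⊆-refl; ⊆-trans)
open import Data.List.Relation.Binary.Sublist.Propositional.Properties
  using (++⁺; ++⁺ʳ; ++⁺ˡ; All-resp-⊆; filter⁺; length-mono-≤)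
open import Data.List.Relation.Unary.All as All using (All; []; _∷_)
import Data.List.Relation.Unary.All.Properties as All
open import Data.List.Relation.Unary.AllPairs as AllPairs using (AllPairs; []; _∷_)
import Data.List.Relation.Unary.AllPairs.Properties as AllPairs
open import Data.List.Relation.Unary.Any using (here; index; there)
open import Data.List.Relation.Unary.Any.Properties using (lookup-index)
open import Data.Nat.Base as ℕ
  using (ℕ; zero; suc; NonZero; _*_; _^_; _<_; _>_; _≤_; s≤s; z≤n)
open import Data.Nat.Combinatorics using (_C_; nC1≡n; nCk+nC[k+1]≡[n+1]C[k+1])
open import Data.Nat.ListAction using (sum)
open import Data.Nat.ListAction.Properties using (sum-++)
open import Data.Nat.Properties
  using (+-comm; +-identityʳ; +-suc; 0≢1+n; <-asym; <-irrefl; <-trans; <-≤-trans; <⇒≤; <⇒≱; >⇒≢;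
         m<1+n⇒m<n∨m≡n; m<n⇒m<1+n; suc-injective; ≤-<-trans; ≤-refl; ≤-reflexive; ≤⇒≯;
         ≰⇒>; _<?_)
open import Data.Nat.Tactic.RingSolver using (solve-∀)
open import Data.Product.Base using (∃-syntax; ∃₂; _×_; _,_; proj₁; proj₂)
open import Data.Sum.Base using (inj₁; inj₂; _⊎_)
open import Function.Base using (_∘_)
open import Relation.Binary.Bundles using (Setoid)
open import Relation.Binary.PropositionalEquality
  using (_≡_; _≢_; cong; cong₂; module ≡-Reasoning; refl; subst; sym; trans)
open import Relation.Nullary.Negation.Core using (¬_)

-- Generating tree: states, moves and levels

-- What decides where the next maximum may be inserted into a good word w. The
-- position of a split w = as ++ bs is length as; position 0 is always allowed.
--   descending m : w is a decreasing word of length m;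
--   cut k ks     : k ∷ ks are the nonzero active positions, and k is the only
--                  position splitting w into two decreasing words;
--   uncut js     : js are the nonzero active positions, and w is not a
--                  concatenation of two decreasing words.
data State : Set where
  descending : ℕ → State
  cut        : ℕ → List ℕ → State
  uncut      : List ℕ → State

-- Inserting at j keeps exactly the active positions ≤ j; lists of positions are
-- decreasing, so these form a suffix.
siteMoves : (ℕ → List ℕ → State) → List ℕ → List (ℕ × State)
siteMoves f []       = []
siteMoves f (j ∷ js) = (j , f j js) ∷ siteMoves f js

moves : State → List (ℕ × State)
moves (descending m) = (0 , descending (suc m)) ∷ siteMoves cut (applyDownFrom suc m)
moves (cut k ks)     = (0 , cut (suc k) []) ∷ (k , cut k ks) ∷ siteMoves (λ j js → uncut (j ∷ js)) ks
moves (uncut js)     = (0 , uncut []) ∷ siteMoves (λ j js → uncut (j ∷ js)) js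

insertAt : ℕ → ℕ → List ℕ → List ℕ
insertAt zero    v xs       = v ∷ xs
insertAt (suc j) v []       = v ∷ []
insertAt (suc j) v (x ∷ xs) = x ∷ insertAt j v xs

Node : Set
Node = List ℕ × State

children : ℕ → Node → List Node
children v (w , s) = map (λ (j , s′) → insertAt j v w , s′) (moves s)

-- The good arrangements of the letters 2, …, m + 1, with their states.
level : ℕ → List Node
level zero    = ([] , descending 0) ∷ []
level (suc m) = concatMap (children (2 ℕ.+ m)) (level m)

-- Subwords of concatenations

⊆-++⁻ : ∀ {A : Set} (xs : List A) {ys ws} → ws ⊆ xs ++ ys →
        ∃₂ λ ps qs → ws ≡ ps ++ qs × ps ⊆ xs × qs ⊆ ys
⊆-++⁻ []       σ = [] , _ , refl , [] , σ
⊆-++⁻ (x ∷ xs) (.x ∷ʳ σ) with ⊆-++⁻ xs σ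
... | ps , qs , eq , ρ , τ = ps , qs , eq , x ∷ʳ ρ , τ
⊆-++⁻ (x ∷ xs) (refl ∷ σ) with ⊆-++⁻ xs σ
... | ps , qs , refl , ρ , τ = x ∷ ps , qs , refl , refl ∷ ρ , τ

⊆-mid⁻ : ∀ {A : Set} (xs : List A) {y ys ws} → ws ⊆ xs ++ y ∷ ys →
         ws ⊆ xs ++ ys ⊎ ∃₂ λ ps qs → ws ≡ ps ++ y ∷ qs × ps ⊆ xs × qs ⊆ ys
⊆-mid⁻ xs σ with ⊆-++⁻ xs σ
... | ps , _ , refl , ρ , _ ∷ʳ τ   = inj₁ (++⁺ ρ τ)
... | ps , _ , refl , ρ , refl ∷ τ = inj₂ (ps , _ , refl , ρ , τ)

⊆-mid⁺ : ∀ {A : Set} (xs : List A) {y ys} → xs ++ ys ⊆ xs ++ y ∷ ys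
⊆-mid⁺ xs = ++⁺ (⊆-refl {x = xs}) (_ ∷ʳ ⊆-refl)

-- Good words and the insertion of a new maximum

record Falling (w : List ℕ) : Set where
  constructor falling
  field no-ascent : ∀ {a b} → a ∷ b ∷ [] ⊆ w → ¬ a < b
open Falling

record Good (w : List ℕ) : Set where
  field
    no-123  : ∀ {a b c} → a ∷ b ∷ c ∷ [] ⊆ w → a < b → ¬ b < c
    no-3412 : ∀ {a b c d} → a ∷ b ∷ c ∷ d ∷ [] ⊆ w → c < d → d < a → ¬ a < b
open Good

-- The positions at which inserting a new maximum keeps a good word good.
record Active (as bs : List ℕ) : Set where
  constructor active
  field
    prefix-falling : Falling as
    no-low-ascent  : ∀ {x a b} → x ∈ as → a ∷ b ∷ [] ⊆ bs → a < b → ¬ b < x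
open Active

Falling-⊆ : ∀ {u w} → u ⊆ w → Falling w → Falling u
Falling-⊆ u⊆w f .no-ascent σ = f .no-ascent (⊆-trans σ u⊆w)

Good-⊆ : ∀ {u w} → u ⊆ w → Good w → Good u
Good-⊆ u⊆w g .no-123  σ = g .no-123 (⊆-trans σ u⊆w)
Good-⊆ u⊆w g .no-3412 σ = g .no-3412 (⊆-trans σ u⊆w)

Active-⊆ : ∀ {as bs cs ds} → cs ⊆ as → ds ⊆ bs → Active as bs → Active cs ds
Active-⊆ ρ τ act .prefix-falling       = Falling-⊆ ρ (act .prefix-falling)
Active-⊆ ρ τ act .no-low-ascent x∈ σ = act .no-low-ascent (to∈ (⊆-trans (from∈ x∈) ρ)) (⊆-trans σ τ)

Falling⇒Active : ∀ {as bs} → Falling as → Falling bs → Active as bs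
Falling⇒Active f g = active f (λ _ σ a<b _ → g .no-ascent σ a<b)

module _ {v : ℕ} where

  ≤-max : ∀ as {bs} → All (_< v) (as ++ bs) → ∀ {x} → x ∈ as ++ v ∷ bs → x ≤ v
  ≤-max as below x∈ with ∈-++⁻ as x∈
  ... | inj₁ x∈as         = <⇒≤ (All.lookup below (∈-++⁺ˡ x∈as))
  ... | inj₂ (here refl)  = ≤-refl
  ... | inj₂ (there x∈bs) = <⇒≤ (All.lookup below (∈-++⁺ʳ as x∈bs))

  -- A forbidden occurrence that uses `v` must use it as its largest letter: the `3` of `123`, which
  -- leaves an ascent in `as`, or the `4` of `3412`, which leaves a low ascent in `bs`. In any other
  -- role `v` would lie below another letter.
  Good-insert : ∀ as {bs} → All (_< v) (as ++ bs) → Good (as ++ bs) → Active as bs →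
                Good (as ++ v ∷ bs)
  Good-insert as {bs} below g act = record { no-123 = 123-free ; no-3412 = 3412-free }
    where
    123-free : ∀ {a b c} → a ∷ b ∷ c ∷ [] ⊆ as ++ v ∷ bs → a < b → ¬ b < c
    123-free σ a<b b<c with ⊆-mid⁻ as σ
    ... | inj₁ τ = g .no-123 τ a<b b<c
    ... | inj₂ ([] , _ , refl , _ , _) =
      <⇒≱ a<b (≤-max as below (to∈ (⊆-trans (_ ∷ʳ refl ∷ minimum _) σ)))
    ... | inj₂ (_ ∷ [] , _ , refl , _ , _) =
      <⇒≱ b<c (≤-max as below (to∈ (⊆-trans (_ ∷ʳ _ ∷ʳ ⊆-refl) σ)))
    ... | inj₂ (_ ∷ _ ∷ [] , _ , refl , ρ , _) = act .prefix-falling .no-ascent ρ a<b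
    ... | inj₂ (_ ∷ _ ∷ _ ∷ [] , _ , () , _ , _)
    ... | inj₂ (_ ∷ _ ∷ _ ∷ _ ∷ _ , _ , () , _ , _)

    3412-free : ∀ {a b c d} → a ∷ b ∷ c ∷ d ∷ [] ⊆ as ++ v ∷ bs → c < d → d < a → ¬ a < b
    3412-free σ c<d d<a a<b with ⊆-mid⁻ as σ
    ... | inj₁ τ = g .no-3412 τ c<d d<a a<b
    ... | inj₂ ([] , _ , refl , _ , _) =
      <⇒≱ a<b (≤-max as below (to∈ (⊆-trans (_ ∷ʳ refl ∷ minimum _) σ)))
    ... | inj₂ (_ ∷ [] , _ , refl , ρ , τ) = act .no-low-ascent (to∈ ρ) τ c<d d<a
    ... | inj₂ (_ ∷ _ ∷ [] , _ , refl , _ , _) =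
      <⇒≱ c<d (≤-max as below (to∈ (⊆-trans (_ ∷ʳ _ ∷ʳ _ ∷ʳ ⊆-refl) σ)))
    ... | inj₂ (_ ∷ _ ∷ _ ∷ [] , _ , refl , _ , _) =
      <⇒≱ d<a (≤-max as below (to∈ (⊆-trans (refl ∷ minimum _) σ)))
    ... | inj₂ (_ ∷ _ ∷ _ ∷ _ ∷ [] , _ , () , _ , _)
    ... | inj₂ (_ ∷ _ ∷ _ ∷ _ ∷ _ ∷ _ , _ , () , _ , _)

  -- Conversely, `v` would complete an ascent of `as` to `123`, and a letter of `as` with a lower
  -- ascent of `bs` to `3412`.
  Active-delete : ∀ as {bs} → All (_< v) (as ++ bs) → Good (as ++ v ∷ bs) → Active as bs
  Active-delete as {bs} below g = active
    (falling λ σ a<b → g .no-123 (++⁺ σ (refl ∷ minimum bs)) a<b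
      (All.lookup below (∈-++⁺ˡ (to∈ (⊆-trans (_ ∷ʳ ⊆-refl) σ)))))
    (λ x∈as τ a<b b<x → g .no-3412 (++⁺ (from∈ x∈as) (refl ∷ τ)) a<b b<x
      (All.lookup below (∈-++⁺ˡ x∈as)))

  Falling-max-∷ : ∀ {bs} → All (_< v) bs → Falling bs → Falling (v ∷ bs)
  Falling-max-∷ below f .no-ascent (_ ∷ʳ σ)   a<b = f .no-ascent σ a<b
  Falling-max-∷ below f .no-ascent (refl ∷ σ) a<b = <-asym a<b (All.lookup below (to∈ σ))

  ¬Falling-ascent-to-max : ∀ x as {bs} → x < v → ¬ Falling (x ∷ as ++ v ∷ bs)
  ¬Falling-ascent-to-max x as x<v f =
    f .no-ascent (refl ∷ ++⁺ˡ as (refl ∷ minimum _)) x<v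

  -- An ascent through `v` is never low, because its top is at least `v` and so exceeds every letter
  -- of `as`.
  Active-insert-right : ∀ {as} cs {bs} → All (_< v) as →
                        Active as (cs ++ bs) → Active as (cs ++ v ∷ bs)
  Active-insert-right {as} cs {bs} below act =
    active (act .prefix-falling) low
    where
    low : ∀ {x a b} → x ∈ as → a ∷ b ∷ [] ⊆ cs ++ v ∷ bs → a < b → ¬ b < x
    low x∈as σ a<b b<x with ⊆-mid⁻ cs σ | All.lookup below x∈as
    ... | inj₁ τ                            | x<v = act .no-low-ascent x∈as τ a<b b<x
    ... | inj₂ ([] , _ , refl , _ , _)      | x<v = <-asym (<-trans a<b b<x) x<v
    ... | inj₂ (_ ∷ [] , _ , refl , _ , _)  | x<v = <-asym b<x x<v
    ... | inj₂ (_ ∷ _ ∷ [] , _ , () , _ , _)      | x<v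
    ... | inj₂ (_ ∷ _ ∷ _ ∷ _ , _ , () , _ , _)  | x<v

  Active-max-∷⁺ : ∀ {as bs} → All (_< v) as → Falling as → Falling bs → Active (v ∷ as) bs
  Active-max-∷⁺ below f g = Falling⇒Active (Falling-max-∷ below f) g

  -- Once `v` belongs to the prefix, every ascent of `bs` is low, so activity forces `bs` to fall.
  Active-max-∷⁻ : ∀ {as bs} → All (_< v) bs → Active (v ∷ as) bs → Falling as × Falling bs
  Active-max-∷⁻ below act =
    Falling-⊆ (_ ∷ʳ ⊆-refl) (act .prefix-falling) ,
    falling λ σ a<b → act .no-low-ascent (here refl) σ a<b
      (All.lookup below (to∈ (⊆-trans (_ ∷ʳ ⊆-refl) σ)))

-- Lists of active positions and their change under insertion

record Sites (w js : List ℕ) : Set where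
  field
    sorted   : AllPairs _>_ js
    sound    : ∀ {j} → j ∈ js → ∃[ x ] ∃[ as ] ∃[ bs ]
               (w ≡ x ∷ as ++ bs × j ≡ suc (length as) × Active (x ∷ as) bs)
    complete : ∀ x as bs → w ≡ x ∷ as ++ bs → Active (x ∷ as) bs → suc (length as) ∈ js
open Sites

∈-applyDownFrom-suc⁺ : ∀ {i n} → i < n → suc i ∈ applyDownFrom suc n
∈-applyDownFrom-suc⁺ {i} {suc n} i<1+n with m<1+n⇒m<n∨m≡n i<1+n
... | inj₁ i<n  = there (∈-applyDownFrom-suc⁺ i<n)
... | inj₂ refl = here refl

∈-applyDownFrom-suc⁻ : ∀ {j} n → j ∈ applyDownFrom suc n → ∃[ i ] (j ≡ suc i × i < n)
∈-applyDownFrom-suc⁻ (suc n) (here refl) = n , refl , ≤-refl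
∈-applyDownFrom-suc⁻ (suc n) (there j∈) with ∈-applyDownFrom-suc⁻ n j∈
... | i , eq , i<n = i , eq , m<n⇒m<1+n i<n

split-at : ∀ {A : Set} (w : List A) i → i < length w →
           ∃[ x ] ∃[ as ] ∃[ bs ] (w ≡ x ∷ as ++ bs × i ≡ length as)
split-at (x ∷ w) zero    _         = x , [] , w , refl , refl
split-at (x ∷ w) (suc i) (s≤s i<n) with split-at w i i<n
... | y , as , bs , refl , refl = x , y ∷ as , bs , refl , refl

Falling-++⁻ : ∀ as {bs} → Falling (as ++ bs) → Falling as × Falling bs
Falling-++⁻ as f = Falling-⊆ (++⁺ʳ _ ⊆-refl) f , Falling-⊆ (++⁺ˡ as ⊆-refl) f

Sites-falling : ∀ {w} → Falling w → Sites w (applyDownFrom suc (length w))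
Sites-falling {w} f .sorted = AllPairs.applyDownFrom⁺₁ suc (length w) (λ j<i _ → s≤s j<i)
Sites-falling {w} f .sound j∈ with ∈-applyDownFrom-suc⁻ (length w) j∈
... | i , refl , i<n with split-at w i i<n
...   | x , as , bs , refl , refl =
  let g , h = Falling-++⁻ (x ∷ as) f in x , as , bs , refl , refl , Falling⇒Active g h
Sites-falling f .complete x as bs refl _ =
  ∈-applyDownFrom-suc⁺ (s≤s (length-++-≤ˡ as))

sorted-tail : ∀ is {i j js} → AllPairs _>_ (is ++ j ∷ js) → i ∈ is ++ j ∷ js → i ≤ j → i ∈ j ∷ js
sorted-tail []       _          i∈         _   = i∈
sorted-tail (i ∷ is) (i> ∷ _)   (here refl) i≤j =
  ⊥-elim (≤⇒≯ i≤j (All.lookup i> (∈-++⁺ʳ is (here refl))))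
sorted-tail (_ ∷ is) (_ ∷ srt)  (there i∈) i≤j = sorted-tail is srt i∈ i≤j

sorted-head : ∀ is {i j js} → AllPairs _>_ (is ++ j ∷ js) → i ∈ j ∷ js → i ≤ j
sorted-head []       _           (here refl) = ≤-refl
sorted-head []       (j> ∷ _)    (there i∈)  = <⇒≤ (All.lookup j> i∈)
sorted-head (_ ∷ is) (_ ∷ srt)   i∈          = sorted-head is srt i∈

sorted-suffix : ∀ is {js} → AllPairs _>_ (is ++ js) → AllPairs _>_ js
sorted-suffix []       srt       = srt
sorted-suffix (_ ∷ is) (_ ∷ srt) = sorted-suffix is srt

prefix-split : ∀ {A : Set} (as cs : List A) {bs ds} → as ++ bs ≡ cs ++ ds → length cs ≤ length as →
               ∃[ es ] (as ≡ cs ++ es × ds ≡ es ++ bs)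
prefix-split as       []       eq _         = as , refl , sym eq
prefix-split (a ∷ as) (c ∷ cs) eq (s≤s c≤a) with ∷-injective eq
... | refl , eq′ with prefix-split as cs eq′ c≤a
...   | es , refl , eq″ = es , refl , eq″

split-unique : ∀ {A : Set} (as cs : List A) {bs ds} → as ++ bs ≡ cs ++ ds → length as ≡ length cs →
               as ≡ cs × bs ≡ ds
split-unique []       []       eq _  = refl , eq
split-unique (a ∷ as) (c ∷ cs) eq ≡l with ∷-injective eq
... | refl , eq′ with split-unique as cs eq′ (suc-injective ≡l)
...   | refl , eq″ = refl , eq″

module _ {v : ℕ} where

  -- The letters `x` and `v` form an ascent, so a falling prefix has to end before `v`.
  falling-prefix : ∀ x as {bs} cs {ds} → x < v → x ∷ as ++ v ∷ bs ≡ cs ++ ds → Falling cs →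
                   ∃[ es ] (x ∷ as ≡ cs ++ es × ds ≡ es ++ v ∷ bs)
  falling-prefix x as cs x<v eq f with ++-split (x ∷ as) cs eq
  ... | inj₁ ([] , refl , refl)     = [] , sym (trans (++-identityʳ _) (++-identityʳ _)) , refl
  ... | inj₁ (_ ∷ _ , refl , refl)  = ⊥-elim (¬Falling-ascent-to-max x as x<v f)
  ... | inj₂ (es , eq₁ , eq₂)       = es , eq₁ , eq₂

  -- An active position of the new word has a falling prefix, hence lies at or before `v`. There `v`
  -- belongs to the right half, where adding or deleting it preserves activity.
  Sites-insert : ∀ x as bs is {js} → All (_< v) (x ∷ as ++ bs) →
                 Sites (x ∷ as ++ bs) (is ++ suc (length as) ∷ js) →
                 Sites (x ∷ as ++ v ∷ bs) (suc (length as) ∷ js)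
  Sites-insert x as bs is below S .sorted = sorted-suffix is (S .sorted)
  Sites-insert x as bs is below S .sound i∈
    with S .sound (∈-++⁺ʳ is i∈) | sorted-head is (S .sorted) i∈
  ... | y , cs , ds , eq , refl , act | i≤j with prefix-split (x ∷ as) (y ∷ cs) eq i≤j
  ...   | es , refl , refl =
    y , cs , es ++ v ∷ bs , cong (y ∷_) (++-assoc cs es _) , refl ,
    Active-insert-right es (All.++⁻ˡ (y ∷ cs) (subst (All _) eq below)) act
  Sites-insert x as bs is below S .complete y cs ds eq act
    with falling-prefix x as (y ∷ cs) (All.head below) eq (act .prefix-falling)
  ... | es , refl , refl =
    sorted-tail is (S .sorted)
      (S .complete y cs (es ++ bs) (cong (y ∷_) (++-assoc cs es bs)) (Active-⊆ ⊆-refl (⊆-mid⁺ es) act))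
      (s≤s (length-++-≤ˡ cs))

  -- With `v` in front, a nonzero position is active exactly when the position before it splits the
  -- old word into two falling words.
  Sites-insert-first : ∀ {w js} → All (_< v) w → AllPairs _>_ js →
    (∀ {j} → j ∈ js → ∃₂ λ as bs → w ≡ as ++ bs × j ≡ suc (length as) × Falling as × Falling bs) →
    (∀ as bs → w ≡ as ++ bs → Falling as → Falling bs → suc (length as) ∈ js) →
    Sites (v ∷ w) js
  Sites-insert-first below srt snd cmp .sorted = srt
  Sites-insert-first below srt snd cmp .sound j∈ with snd j∈
  ... | as , bs , refl , refl , f , g =
    v , as , bs , refl , refl , Active-max-∷⁺ (All.++⁻ˡ as below) f g
  Sites-insert-first below srt snd cmp .complete x as bs refl act =
    let f , g = Active-max-∷⁻ (All.++⁻ʳ as below) act in cmp as bs refl f g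

-- Correctness of the moves

siteList : State → List ℕ
siteList (descending m) = applyDownFrom suc m
siteList (cut k ks)     = k ∷ ks
siteList (uncut js)     = js

-- In the case `cut`, existence makes the position after `k` active once a maximum is inserted in
-- front, and uniqueness excludes every other nonzero position.
Cuts : List ℕ → State → Set
Cuts w (descending m) = length w ≡ m × Falling w
Cuts w (cut k _)      = (∀ as bs → w ≡ as ++ bs → Falling as → Falling bs → length as ≡ k) ×
                        ∃₂ λ as bs → w ≡ as ++ bs × length as ≡ k × Falling as × Falling bs
Cuts w (uncut _)      = ∀ as bs → w ≡ as ++ bs → Falling as → ¬ Falling bs

record Describes (w : List ℕ) (s : State) : Set where
  constructor describes
  field
    sites : Sites w (siteList s)
    cuts  : Cuts w s
open Describes

siteMoves-positions : ∀ {f} js → map proj₁ (siteMoves f js) ≡ js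
siteMoves-positions []       = refl
siteMoves-positions (j ∷ js) = cong (j ∷_) (siteMoves-positions js)

moves-positions : ∀ s → map proj₁ (moves s) ≡ 0 ∷ siteList s
moves-positions (descending m) = cong (0 ∷_) (siteMoves-positions (applyDownFrom suc m))
moves-positions (cut k ks)     = cong (λ js → 0 ∷ k ∷ js) (siteMoves-positions ks)
moves-positions (uncut js)     = cong (0 ∷_) (siteMoves-positions js)

∈-siteMoves⁻ : ∀ {f p js} → p ∈ siteMoves f js →
               ∃[ is ] ∃[ j ] ∃[ ks ] (js ≡ is ++ j ∷ ks × p ≡ (j , f j ks))
∈-siteMoves⁻ {js = j ∷ js} (here refl) = [] , j , js , refl , refl
∈-siteMoves⁻ {js = j ∷ js} (there p∈) with ∈-siteMoves⁻ p∈
... | is , i , ks , refl , eq = j ∷ is , i , ks , refl , eq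

record Child (v : ℕ) (w : List ℕ) (p : ℕ × State) : Set where
  constructor child
  field
    {before after} : List ℕ
    word-split     : w ≡ before ++ after
    position       : length before ≡ proj₁ p
    is-active      : Active before after
    new-describes  : Describes (before ++ v ∷ after) (proj₂ p)

module _ {v : ℕ} where

  child-at-site : ∀ {w is j js s} → All (_< v) w → Sites w (is ++ j ∷ js) → siteList s ≡ j ∷ js →
    (∀ x as bs → w ≡ x ∷ as ++ bs → j ≡ suc (length as) → Cuts (x ∷ as ++ v ∷ bs) s) →
    Child v w (j , s)
  child-at-site {is = is} below S eq c with S .sound (∈-++⁺ʳ is (here refl))
  ... | x , as , bs , refl , refl , act =
    child refl refl act (describes (subst (Sites _) (sym eq) (Sites-insert x as bs is below S))
      (c x as bs refl refl))

  -- The falling left part ends before `v`, and the falling right part cannot contain a letter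
  -- preceding `v`. So the split is just before `v`, and deleting `v` leaves a split of the old
  -- word.
  insert-cut : ∀ x as {bs} cs {ds} → All (_< v) (x ∷ as) → x ∷ as ++ v ∷ bs ≡ cs ++ ds →
               Falling cs → Falling ds → length cs ≡ suc (length as) × Falling (x ∷ as) × Falling bs
  insert-cut x as cs below eq f g with falling-prefix x as cs (All.head below) eq f
  ... | []     , eq₁ , refl =
    let cs≡ = trans (sym (++-identityʳ cs)) (sym eq₁) in
    cong length cs≡ , subst Falling cs≡ f , Falling-⊆ (_ ∷ʳ ⊆-refl) g
  ... | e ∷ es , eq₁ , refl =
    ⊥-elim (¬Falling-ascent-to-max e es
      (All.lookup below (subst (e ∈_) (sym eq₁) (∈-++⁺ʳ cs (here refl)))) g)

  children-described : ∀ {w} s → All (_< v) w → Describes w s → All (Child v w) (moves s)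
  children-described {w} (descending m) below (describes S (refl , f)) =
    child {before = []} refl refl (active (Falling-⊆ (minimum w) f) λ ())
      (describes (Sites-falling f′) (refl , f′)) ∷
    All.tabulate at-site
    where
    f′ : Falling (v ∷ w)
    f′ = Falling-max-∷ below f
    at-site : ∀ {p} → p ∈ siteMoves cut (applyDownFrom suc m) → Child v w p
    at-site p∈ with ∈-siteMoves⁻ p∈
    ... | is , j , js , eq , refl =
      child-at-site below (subst (Sites w) eq S) refl cuts′
      where
      -- All of `w` falls, so both sides of the insertion point fall, and `v` may head the right
      -- one.
      cuts′ : ∀ x as bs → w ≡ x ∷ as ++ bs → j ≡ suc (length as) → Cuts (x ∷ as ++ v ∷ bs) (cut j js)
      cuts′ x as bs refl refl =
        let g , h = Falling-++⁻ (x ∷ as) f in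
        (λ cs ds eq f g → proj₁ (insert-cut x as cs (All.++⁻ˡ (x ∷ as) below) eq f g)) ,
        x ∷ as , v ∷ bs , refl , refl , g , Falling-max-∷ (All.++⁻ʳ (x ∷ as) below) h
  children-described {w} (cut k ks) below (describes S (only , as , bs , refl , refl , f , g)) =
    child {before = []} refl refl (active (Falling-⊆ (minimum as) f) λ ())
      (describes first-sites first-cuts) ∷
    child-at-site {is = []} below S refl cuts₁ ∷
    All.tabulate at-site
    where
    -- The split position is a site, hence a successor. This excludes the empty left part in
    -- `first-cuts`, which would put a split of the old word at `0`.
    k≢0 : length as ≢ 0
    k≢0 k≡0 with S .sound (here refl)
    ... | _ , _ , _ , _ , k≡suc , _ = 0≢1+n (trans (sym k≡0) k≡suc)
    first-sites : Sites (v ∷ as ++ bs) (suc (length as) ∷ [])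
    first-sites = Sites-insert-first below ([] ∷ [])
      (λ { (here refl) → as , bs , refl , refl , f , g })
      (λ cs ds eq f g → here (cong suc (only cs ds eq f g)))
    first-cuts : Cuts (v ∷ as ++ bs) (cut (suc (length as)) [])
    first-cuts =
      (λ { []       ds refl f g → ⊥-elim (k≢0 (sym (only [] _ refl f (Falling-⊆ (_ ∷ʳ ⊆-refl) g))))
         ; (_ ∷ cs) ds eq   f g →
             cong suc (only cs ds (proj₂ (∷-injective eq)) (Falling-⊆ (_ ∷ʳ ⊆-refl) f) g) }) ,
      v ∷ as , bs , refl , refl , Falling-max-∷ (All.++⁻ˡ as below) f , g
    cuts₁ : ∀ x cs ds → as ++ bs ≡ x ∷ cs ++ ds → length as ≡ suc (length cs) →
            Cuts (x ∷ cs ++ v ∷ ds) (cut (length as) ks)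
    cuts₁ x cs ds eq k≡ with split-unique as (x ∷ cs) eq k≡
    ... | refl , refl =
      (λ us vs eq f g → proj₁ (insert-cut x cs us (All.++⁻ˡ (x ∷ cs) below) eq f g)) ,
      x ∷ cs , v ∷ bs , refl , refl , f , Falling-max-∷ (All.++⁻ʳ (x ∷ cs) below) g
    at-site : ∀ {p} → p ∈ siteMoves (λ j js → uncut (j ∷ js)) ks → Child v (as ++ bs) p
    at-site p∈ with ∈-siteMoves⁻ p∈
    ... | is , j , js , refl , refl =
      -- By `insert-cut` a split of the new word would split the old word at `j`. Uniqueness would
      -- give `j` equal to the cut position, but `j` comes after it in a strictly decreasing list.
      child-at-site {is = _ ∷ is} below S refl λ x cs ds eq j≡ us vs eq′ f g →
        let _ , f′ , g′ = insert-cut x cs us (All.++⁻ˡ (x ∷ cs) (subst (All _) eq below)) eq′ f g in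
        <-irrefl (trans j≡ (only (x ∷ cs) ds eq f′ g′))
          (All.lookup (AllPairs.head (S .sorted)) (∈-++⁺ʳ is (here refl)))
  children-described {w} (uncut js) below (describes S none) =
    child {before = []} refl refl (active (falling λ ()) λ ())
      (describes (Sites-insert-first below [] (λ ()) (λ as bs eq f g → ⊥-elim (none as bs eq f g)))
        first-cuts) ∷
    All.tabulate at-site
    where
    first-cuts : Cuts (v ∷ w) (uncut [])
    first-cuts []       _ refl f g = none [] w refl f (Falling-⊆ (_ ∷ʳ ⊆-refl) g)
    first-cuts (_ ∷ cs) ds eq  f g = none cs ds (proj₂ (∷-injective eq)) (Falling-⊆ (_ ∷ʳ ⊆-refl) f) g
    at-site : ∀ {p} → p ∈ siteMoves (λ j js → uncut (j ∷ js)) js → Child v w p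
    at-site p∈ with ∈-siteMoves⁻ p∈
    ... | is , j , js , refl , refl =
      child-at-site below S refl λ x cs ds eq j≡ us vs eq′ f g →
        let _ , f′ , g′ = insert-cut x cs us (All.++⁻ˡ (x ∷ cs) (subst (All _) eq below)) eq′ f g in
        none (x ∷ cs) ds eq f′ g′

-- The levels list each good word exactly once

letters : ℕ → List ℕ
letters = applyUpTo (λ i → 2 ℕ.+ i)

letters-suc : ∀ m → letters (suc m) ≡ letters m ++ [ 2 ℕ.+ m ]
letters-suc m = sym (applyUpTo-∷ʳ (λ i → 2 ℕ.+ i) m)

letters-< : ∀ {m w} → w ↭ letters m → All (_< 2 ℕ.+ m) w
letters-< {m} w↭ = All-resp-↭ (↭-sym w↭) (All.applyUpTo⁺₁ _ m (λ i<m → s≤s (s≤s i<m)))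

letters-insert : ∀ {m} as {bs} → as ++ bs ↭ letters m → as ++ (2 ℕ.+ m) ∷ bs ↭ letters (suc m)
letters-insert {m} as {bs} ↭m =
  ↭-trans (shift (2 ℕ.+ m) as bs)
    (↭-trans (prep _ ↭m) (↭-trans (∷↭∷ʳ _ _) (↭-reflexive (sym (letters-suc m)))))

insertAt-++ : ∀ v as {bs} → insertAt (length as) v (as ++ bs) ≡ as ++ v ∷ bs
insertAt-++ v []       = refl
insertAt-++ v (a ∷ as) = cong (a ∷_) (insertAt-++ v as)

-- The letter `v` exceeds all others, so it occurs once and marks the split. A child thus determines
-- its parent and the insertion position.
mid-injective : ∀ {v} as cs {bs ds} → All (_< v) (as ++ bs) → All (_< v) (cs ++ ds) →
                as ++ v ∷ bs ≡ cs ++ v ∷ ds → as ≡ cs × bs ≡ ds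
mid-injective []       []       _ _ refl = refl , refl
mid-injective []       (c ∷ cs) _ (c<v ∷ _) eq with ∷-injective eq
... | refl , _ = ⊥-elim (<-irrefl refl c<v)
mid-injective (a ∷ as) []       (a<v ∷ _) _ eq with ∷-injective eq
... | refl , _ = ⊥-elim (<-irrefl refl a<v)
mid-injective (a ∷ as) (c ∷ cs) (_ ∷ p) (_ ∷ q) eq with ∷-injective eq
... | refl , eq′ with mid-injective as cs p q eq′
...   | refl , refl = refl , refl

AllPairs-both : ∀ {A : Set} {P : A → Set} {R : A → A → Set} {xs} → All P xs → AllPairs R xs →
                AllPairs (λ x y → P x × P y × R x y) xs
AllPairs-both []       []        = []
AllPairs-both (p ∷ ps) (rs ∷ rss) =
  All.zipWith (λ (q , r) → p , q , r) (ps , rs) ∷ AllPairs-both ps rss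

record Valid (m : ℕ) (n : Node) : Set where
  constructor valid
  field
    word-↭        : proj₁ n ↭ letters m
    word-good     : Good (proj₁ n)
    state-correct : Describes (proj₁ n) (proj₂ n)
open Valid

Distinct : Node → Node → Set
Distinct n n′ = proj₁ n ≢ proj₁ n′

valid-children : ∀ {m n} → Valid m n → All (Child (2 ℕ.+ m) (proj₁ n)) (moves (proj₂ n))
valid-children (valid w↭ g d) = children-described _ (letters-< w↭) d

child-valid : ∀ {m n p} → Valid m n → Child (2 ℕ.+ m) (proj₁ n) p →
              Valid (suc m) (insertAt (proj₁ p) (2 ℕ.+ m) (proj₁ n) , proj₂ p)
child-valid {m} (valid w↭ g _) (child {as} {bs} refl refl act d)
  rewrite insertAt-++ (2 ℕ.+ m) as {bs} =
    valid (letters-insert as w↭) (Good-insert as (letters-< w↭) g act) d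

level-valid : ∀ m → All (Valid m) (level m)
level-valid zero    = valid ↭-refl (record { no-123 = λ () ; no-3412 = λ () })
                        (describes (Sites-falling (falling λ ())) (refl , falling λ ())) ∷ []
level-valid (suc m) = All.concat⁺ (All.map⁺ (All.map
  (λ n! → All.map⁺ (All.map (child-valid n!) (valid-children n!))) (level-valid m)))

active-position : ∀ {w s} → Describes w s → ∀ as bs → w ≡ as ++ bs → Active as bs →
                  length as ∈ map proj₁ (moves s)
active-position {s = s} d as bs eq act rewrite moves-positions s with as
... | []     = here refl
... | x ∷ as = there (d .sites .complete x as bs eq act)

-- Deleting the maximum leaves a good word of the previous level, and `Active-delete` shows that the
-- vacated position is one of the moves of that word.
level-complete : ∀ m {w} → w ↭ letters m → Good w → ∃[ s ] ((w , s) ∈ level m)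
level-complete zero    w↭ g rewrite ↭-empty-inv w↭ = _ , here refl
level-complete (suc m) w↭ g
  with ∈-∃++ (∈-resp-↭ (↭-sym w↭)
         (subst (2 ℕ.+ m ∈_) (sym (letters-suc m)) (∈-++⁺ʳ (letters m) (here refl))))
... | as , bs , refl = extend (level-complete m parent↭ (Good-⊆ (⊆-mid⁺ as) g))
  where
  parent↭ : as ++ bs ↭ letters m
  parent↭ = ↭-trans (drop-mid as (letters m) (↭-trans w↭ (↭-reflexive (letters-suc m))))
                    (↭-reflexive (++-identityʳ _))
  extend : ∃[ s ] ((as ++ bs , s) ∈ level m) → ∃[ s ] ((as ++ (2 ℕ.+ m) ∷ bs , s) ∈ level (suc m))
  extend (s , n∈)
    with ∈-map⁻ proj₁ (active-position (All.lookup (level-valid m) n∈ .state-correct) as bs refl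
           (Active-delete as (letters-< parent↭) g))
  ... | (_ , s′) , p∈ , refl =
    s′ , ∈-concatMap⁺ (children (2 ℕ.+ m)) {xs = level m} (lose n∈
           (subst (λ w → (w , s′) ∈ children (2 ℕ.+ m) (as ++ bs , s)) (insertAt-++ (2 ℕ.+ m) as)
             (∈-map⁺ _ p∈)))

moves-distinct : ∀ {w s} → Describes w s → AllPairs (λ p q → proj₁ p ≢ proj₁ q) (moves s)
moves-distinct {s = s} d = AllPairs.map⁻ (subst (AllPairs _≢_) (sym (moves-positions s))
  (All.tabulate nonzero ∷ AllPairs.map >⇒≢ (d .sites .sorted)))
  where
  nonzero : ∀ {j} → j ∈ siteList s → 0 ≢ j
  nonzero j∈ refl with d .sites .sound j∈
  ... | _ , _ , _ , _ , () , _

siblings-distinct : ∀ {m n} → Valid m n → AllPairs Distinct (children (2 ℕ.+ m) n)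
siblings-distinct {m} {n} n!@(valid w↭ _ d) =
  AllPairs.map⁺ (AllPairs.map distinct (AllPairs-both (valid-children n!) (moves-distinct d)))
  where
  distinct : ∀ {p q} → Child (2 ℕ.+ m) (proj₁ n) p × Child (2 ℕ.+ m) (proj₁ n) q × proj₁ p ≢ proj₁ q →
             insertAt (proj₁ p) (2 ℕ.+ m) (proj₁ n) ≢ insertAt (proj₁ q) (2 ℕ.+ m) (proj₁ n)
  distinct (child {as} {bs} refl refl _ _ , child {cs} {ds} eq refl _ _ , p≢q) same = p≢q (cong length
    (proj₁ (mid-injective as cs (letters-< w↭) (letters-< (subst (_↭ letters m) eq w↭))
      (trans (sym (insertAt-++ (2 ℕ.+ m) as)) (trans same
        (trans (cong (insertAt (length cs) (2 ℕ.+ m)) eq) (insertAt-++ (2 ℕ.+ m) cs)))))))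

cousins-distinct : ∀ {m n n′} → Valid m n → Valid m n′ → Distinct n n′ →
                   All (λ c → All (Distinct c) (children (2 ℕ.+ m) n′)) (children (2 ℕ.+ m) n)
cousins-distinct {m} {n} {n′} n! n′! n≢n′ =
  All.map⁺ (All.map (λ c → All.map⁺ (All.map (distinct c) (valid-children n′!))) (valid-children n!))
  where
  distinct : ∀ {p q} → Child (2 ℕ.+ m) (proj₁ n) p → Child (2 ℕ.+ m) (proj₁ n′) q →
             insertAt (proj₁ p) (2 ℕ.+ m) (proj₁ n) ≢ insertAt (proj₁ q) (2 ℕ.+ m) (proj₁ n′)
  distinct (child {as} {bs} refl refl _ _) (child {cs} {ds} refl refl _ _) same
    with mid-injective as cs (letters-< (n! .word-↭)) (letters-< (n′! .word-↭))
           (trans (sym (insertAt-++ (2 ℕ.+ m) as)) (trans same (insertAt-++ (2 ℕ.+ m) cs)))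
  ... | refl , refl = n≢n′ refl

level-distinct : ∀ m → AllPairs Distinct (level m)
level-distinct zero    = [] ∷ []
level-distinct (suc m) = AllPairs.concat⁺
  (All.map⁺ (All.map siblings-distinct (level-valid m)))
  (AllPairs.map⁺ (AllPairs.map (λ (n! , n′! , n≢n′) → cousins-distinct n! n′! n≢n′)
    (AllPairs-both (level-valid m) (level-distinct m))))

-- Occurrences of 1234 in terms of linear words

rank : ℕ → List ℕ → ℕ
rank x ws = length (filter (_<? x) ws)

rank-mono : ∀ {x y} ws → x ≤ y → rank x ws ≤ rank y ws
rank-mono {x} {y} ws x≤y =
  length-mono-≤ (filter⁺ (_<? x) (_<? y) (λ { refl a<x → <-≤-trans a<x x≤y }) (⊆-refl {x = ws}))

-- The contrapositive of monotonicity; it reads inequalities off a reduced form without assuming the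
-- letters distinct.
rank-reflects-< : ∀ {x y} ws → rank x ws < rank y ws → x < y
rank-reflects-< ws r = ≰⇒> λ y≤x → <⇒≱ r (rank-mono ws y≤x)

rank-∷-< : ∀ {x y} ws → y < x → rank x (y ∷ ws) ≡ suc (rank x ws)
rank-∷-< {x} ws y<x = cong length (filter-accept (_<? x) y<x)

rank-∷-≥ : ∀ {x y} ws → x ≤ y → rank x (y ∷ ws) ≡ rank x ws
rank-∷-≥ {x} ws x≤y = cong length (filter-reject (_<? x) (≤⇒≯ x≤y))

increasing⇒1234 : ∀ {a b c d} → a < b → b < c → c < d →
                  reduce (a ∷ b ∷ c ∷ d ∷ []) ≡ 1 ∷ 2 ∷ 3 ∷ 4 ∷ []
increasing⇒1234 {a} {b} {c} {d} a<b b<c c<d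
  -- Four rewrites for each letter, one for each comparison that its rank makes.
  rewrite rank-∷-≥ (b ∷ c ∷ d ∷ []) (≤-refl {a})
        | rank-∷-≥ (c ∷ d ∷ []) (<⇒≤ a<b)
        | rank-∷-≥ (d ∷ []) (<⇒≤ (<-trans a<b b<c))
        | rank-∷-≥ [] (<⇒≤ (<-trans a<b (<-trans b<c c<d)))
        | rank-∷-< (b ∷ c ∷ d ∷ []) a<b
        | rank-∷-≥ (c ∷ d ∷ []) (≤-refl {b})
        | rank-∷-≥ (d ∷ []) (<⇒≤ b<c)
        | rank-∷-≥ [] (<⇒≤ (<-trans b<c c<d))
        | rank-∷-< (b ∷ c ∷ d ∷ []) (<-trans a<b b<c)
        | rank-∷-< (c ∷ d ∷ []) b<c
        | rank-∷-≥ (d ∷ []) (≤-refl {c})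
        | rank-∷-≥ [] (<⇒≤ c<d)
        | rank-∷-< (b ∷ c ∷ d ∷ []) (<-trans a<b (<-trans b<c c<d))
        | rank-∷-< (c ∷ d ∷ []) (<-trans b<c c<d)
        | rank-∷-< (d ∷ []) c<d
        | rank-∷-≥ [] (≤-refl {d}) = refl

1234⇒increasing : ∀ ws → reduce ws ≡ 1 ∷ 2 ∷ 3 ∷ 4 ∷ [] →
  ∃[ a ] ∃[ b ] ∃[ c ] ∃[ d ] (ws ≡ a ∷ b ∷ c ∷ d ∷ [] × a < b × b < c × c < d)
1234⇒increasing ws@(a ∷ b ∷ c ∷ d ∷ []) eq
  with ∷-injective eq
... | ra , eq₁ with ∷-injective eq₁
...   | rb , eq₂ with ∷-injective eq₂
...     | rc , eq₃ with ∷-injective eq₃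
...       | rd , _ = a , b , c , d , refl , lt ra rb , lt rb rc , lt rc rd
  where
  lt : ∀ {x y i} → suc (rank x ws) ≡ i → suc (rank y ws) ≡ suc i → x < y
  lt refl eq = rank-reflects-< ws (≤-reflexive (sym (suc-injective eq)))

τ₁₂₃₄ : List ℕ
τ₁₂₃₄ = 1 ∷ 2 ∷ 3 ∷ 4 ∷ []

Avoids-resp-≈ʳ : ∀ {τ xs ys} → xs ≈ʳ ys → Avoids τ xs → Avoids τ ys
Avoids-resp-≈ʳ xs≈ys av (zs , ws , ys≈zs , ws⊆ , eq) = av (zs , ws , ≈ʳ-trans xs≈ys ys≈zs , ws⊆ , eq)

⊆-∷⁻ : ∀ {a x : ℕ} {ws xs} → x < a → a ∷ ws ⊆ x ∷ xs → a ∷ ws ⊆ xs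
⊆-∷⁻ x<a (_ ∷ʳ σ)   = σ
⊆-∷⁻ x<a (refl ∷ _) = ⊥-elim (<-irrefl refl x<a)

⊆-split : ∀ {A : Set} (us : List A) {vs xs} → us ++ vs ⊆ xs →
          ∃₂ λ ps qs → xs ≡ ps ++ qs × us ⊆ ps × vs ⊆ qs
⊆-split []       σ = [] , _ , refl , [] , σ
⊆-split (u ∷ us) (y ∷ʳ σ) with ⊆-split (u ∷ us) σ
... | ps , qs , refl , ρ , τ = y ∷ ps , qs , refl , y ∷ʳ ρ , τ
⊆-split (u ∷ us) (refl ∷ σ) with ⊆-split us σ
... | ps , qs , refl , ρ , τ = u ∷ ps , qs , refl , refl ∷ ρ , τ

-- The initial `1` extends a `123` to `1234`. Rotating between the `34` and the `12` of a `3412`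
-- turns it into `1234`.
avoids⇒good : ∀ {xs} → All (1 <_) xs → Avoids τ₁₂₃₄ (1 ∷ xs) → Good xs
avoids⇒good {xs} 1< av = record { no-123 = 123-free ; no-3412 = 3412-free }
  where
  123-free : ∀ {a b c} → a ∷ b ∷ c ∷ [] ⊆ xs → a < b → ¬ b < c
  123-free σ a<b b<c = av
    (1 ∷ xs , _ , ≈ʳ-refl , refl ∷ σ , increasing⇒1234 (All.head (All-resp-⊆ σ 1<)) a<b b<c)
  3412-free : ∀ {a b c d} → a ∷ b ∷ c ∷ d ∷ [] ⊆ xs → c < d → d < a → ¬ a < b
  3412-free {a} {b} σ c<d d<a a<b with ⊆-split (a ∷ b ∷ []) σ
  ... | ps , qs , refl , ρ , τ = av
    (qs ++ 1 ∷ ps , _ , (1 ∷ ps , qs , refl , refl) , ++⁺ τ (1 ∷ʳ ρ) , increasing⇒1234 c<d d<a a<b)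

-- Undoing the rotation turns an occurrence `abcd` into `abcd`, `bcda`, `cdab` or `dabc` inside
-- `1 ∷ xs`. Each of these leaves a `123` or a `3412` in `xs`.
good⇒avoids : ∀ {xs} → All (1 <_) xs → Good xs → Avoids τ₁₂₃₄ (1 ∷ xs)
good⇒avoids {xs} 1< g (_ , ws , (us , vs , eq , refl) , σ , red)
  with 1234⇒increasing ws red
... | a , b , c , d , refl , a<b , b<c , c<d with ⊆-++⁻ vs σ
...   | ps , qs , eq′ , ρ , τ = split ps qs eq′ (subst (qs ++ ps ⊆_) (sym eq) (++⁺ τ ρ))
  where
  1≤ : ∀ {x ys} → x ∷ ys ⊆ 1 ∷ xs → 1 ≤ x
  1≤ σ = All.head (All-resp-⊆ σ (≤-refl ∷ All.map <⇒≤ 1<))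
  no-bcd : ¬ b ∷ c ∷ d ∷ [] ⊆ xs
  no-bcd σ = g .no-123 σ b<c c<d
  split : ∀ ps qs → a ∷ b ∷ c ∷ d ∷ [] ≡ ps ++ qs → ¬ qs ++ ps ⊆ 1 ∷ xs
  split []                       _ refl (_ ∷ʳ σ)   = no-bcd (⊆-trans (_ ∷ʳ ⊆-refl) σ)
  split []                       _ refl (refl ∷ σ) = no-bcd σ
  -- In the three cyclically shifted cases the first letter exceeds a later one, so it is not the
  -- initial `1`, and `⊆-∷⁻` moves the subword into `xs`.
  split (_ ∷ [])                 _ refl σ =
    no-bcd (⊆-trans (refl ∷ refl ∷ refl ∷ minimum _)
      (⊆-∷⁻ (≤-<-trans (1≤ (⊆-trans (_ ∷ʳ _ ∷ʳ _ ∷ʳ ⊆-refl) σ)) a<b) σ))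
  split (_ ∷ _ ∷ [])             _ refl σ =
    g .no-3412 (⊆-∷⁻ (≤-<-trans (1≤ (⊆-trans (_ ∷ʳ _ ∷ʳ ⊆-refl) σ)) (<-trans a<b b<c)) σ) a<b b<c c<d
  split (_ ∷ _ ∷ _ ∷ [])         _ refl σ =
    g .no-123 (⊆-trans (_ ∷ʳ ⊆-refl) (⊆-∷⁻ (≤-<-trans (1≤ (⊆-trans (_ ∷ʳ refl ∷ minimum _) σ))
      (<-trans a<b (<-trans b<c c<d))) σ)) a<b b<c
  split (_ ∷ _ ∷ _ ∷ _ ∷ [])     _ refl (_ ∷ʳ σ)   = no-bcd (⊆-trans (_ ∷ʳ ⊆-refl) σ)
  split (_ ∷ _ ∷ _ ∷ _ ∷ [])     _ refl (refl ∷ σ) = no-bcd σ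

-- Bijection between circular avoiders and a level

letters-> : ∀ {m w} → w ↭ letters m → All (1 <_) w
letters-> {m} w↭ = All-resp-↭ (↭-sym w↭) (All.applyUpTo⁺₂ _ m (λ _ → s≤s (s≤s z≤n)))

rotate-to-1 : ∀ {m xs} → xs ↭ 1 ∷ letters m → ∃[ w ] (w ↭ letters m × xs ≈ʳ 1 ∷ w)
rotate-to-1 {m} xs↭ with ∈-∃++ (∈-resp-↭ (↭-sym xs↭) (here refl))
... | us , vs , refl =
  vs ++ us , ↭-trans (++-comm vs us) (drop-mid us [] xs↭) , us , 1 ∷ vs , refl , refl

-- A rotation with both pieces nonempty would need a second `1` inside `w`.
≈ʳ-from-1 : ∀ {w w′} → All (1 <_) w → 1 ∷ w ≈ʳ 1 ∷ w′ → w ≡ w′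
≈ʳ-from-1 _  ([]     , vs     , refl , eq)   = sym (proj₂ (∷-injective (trans eq (++-identityʳ vs))))
≈ʳ-from-1 _  (_ ∷ us , []     , eq   , refl) = proj₂ (∷-injective (trans eq (++-identityʳ _)))
≈ʳ-from-1 1< (_ ∷ us , _ ∷ vs , refl , refl) =
  ⊥-elim (<-irrefl refl (All.lookup 1< (∈-++⁺ʳ us (here refl))))

distinct-lookup : ∀ {ns} → AllPairs Distinct ns → ∀ i j →
                  proj₁ (lookup ns i) ≡ proj₁ (lookup ns j) → i ≡ j
distinct-lookup (_ ∷ _)  zero    zero    _  = refl
distinct-lookup (d ∷ _)  zero    (suc j) eq = ⊥-elim (All.lookup d (∈-lookup j) eq)
distinct-lookup (d ∷ _)  (suc i) zero    eq = ⊥-elim (All.lookup d (∈-lookup i) (sym eq))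
distinct-lookup (_ ∷ ds) (suc i) (suc j) eq = cong suc (distinct-lookup ds i j eq)

-- Every class has a representative starting with `1`, whose tail is in the level by
-- `level-complete`. By `≈ʳ-from-1` and `level-distinct` its index depends on the class only.
avoiders-cardinality : ∀ m → HasCardinality (Avoiders (suc m) τ₁₂₃₄) (length (level m))
avoiders-cardinality m = record
  { to        = λ π → proj₁ (locate π)
  ; from      = avoider
  ; to-cong   = λ {π} {π′} π≈π′ → word-injective _ _
      (≈ʳ-trans (≈ʳ-sym (proj₂ (locate π))) (≈ʳ-trans π≈π′ (proj₂ (locate π′))))
  ; from-cong = λ { refl → ≈ʳ-refl }
  ; inverse   = (λ {i} {π} π≈ → word-injective _ _ (≈ʳ-trans (≈ʳ-sym (proj₂ (locate π))) π≈))
              , (λ { {π} refl → ≈ʳ-sym (proj₂ (locate π)) })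
  }
  where
  open Setoid (Avoiders (suc m) τ₁₂₃₄) using (Carrier)

  word : Fin (length (level m)) → List ℕ
  word i = proj₁ (lookup (level m) i)

  word-valid : ∀ i → Valid m (lookup (level m) i)
  word-valid i = All.lookup (level-valid m) (∈-lookup i)

  avoider : Fin (length (level m)) → Carrier
  avoider i = (1 ∷ word i , prep 1 (word-valid i .word-↭)) ,
              good⇒avoids (letters-> (word-valid i .word-↭)) (word-valid i .word-good)

  word-injective : ∀ i j → 1 ∷ word i ≈ʳ 1 ∷ word j → i ≡ j
  word-injective i j eq =
    distinct-lookup (level-distinct m) i j (≈ʳ-from-1 (letters-> (word-valid i .word-↭)) eq)

  locate : (π : Carrier) → ∃[ i ] (proj₁ (proj₁ π) ≈ʳ 1 ∷ word i)
  locate ((xs , xs↭) , av) with rotate-to-1 xs↭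
  ... | w , w↭ , xs≈ with level-complete m w↭ (avoids⇒good (letters-> w↭) (Avoids-resp-≈ʳ xs≈ av))
  ...   | _ , n∈ = index n∈ , subst (λ n → xs ≈ʳ 1 ∷ proj₁ n) (lookup-index n∈) xs≈

-- Counting the nodes of the generating tree

module _ where
  open import Data.Nat.Base using (_+_)

  -- The number of descendants of `s` exactly `r` generations below it.
  weight : ℕ → State → ℕ
  weight zero    s = 1
  weight (suc r) s = sum (map (weight r ∘ proj₂) (moves s))

  sum₁ : (ℕ → ℕ) → ℕ → ℕ
  sum₁ f zero    = 0
  sum₁ f (suc t) = f (suc t) + sum₁ f t

  -- binomial r t = (r + t) choose t
  binomial : ℕ → ℕ → ℕ
  binomial zero    t = 1
  binomial (suc r) t = binomial r 0 + sum₁ (binomial r) t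

  binomial-0 : ∀ r → binomial r 0 ≡ 1
  binomial-0 zero    = refl
  binomial-0 (suc r) = trans (+-identityʳ _) (binomial-0 r)

  binomial-1 : ∀ r → binomial r 1 ≡ suc r
  binomial-1 zero    = refl
  binomial-1 (suc r) rewrite binomial-0 r | binomial-1 r | +-identityʳ r = refl

  pascal : ∀ r t → binomial (suc r) (suc t) ≡ binomial (suc r) t + binomial r (suc t)
  pascal r t = lemma (binomial r 0) (binomial r (suc t)) (sum₁ (binomial r) t)
    where
    lemma : ∀ a b c → a + (b + c) ≡ a + c + b
    lemma = solve-∀

  -- The weights depend on a suffix of positions only through its length, and the nonempty suffixes
  -- have lengths from `length js` down to `1`.
  weight-siteMoves : ∀ r {f} (g : ℕ → ℕ) → (∀ j js → weight r (f j js) ≡ g (suc (length js))) →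
                     ∀ js → sum (map (weight r ∘ proj₂) (siteMoves f js)) ≡ sum₁ g (length js)
  weight-siteMoves r g eq []       = refl
  weight-siteMoves r g eq (j ∷ js) = cong₂ _+_ (eq j js) (weight-siteMoves r g eq js)

  -- The moves of `uncut` follow the recursion of `binomial`: the front insertion gives the term at
  -- `0`, the sites give the others.
  weight-uncut : ∀ r js → weight r (uncut js) ≡ binomial r (length js)
  weight-uncut zero    js = refl
  weight-uncut (suc r) js =
    cong₂ _+_ (weight-uncut r []) (weight-siteMoves r (binomial r) (λ j js → weight-uncut r (j ∷ js)) js)

  weight-cut-[] : ∀ r k → weight r (cut k []) ≡ 2 ^ r
  weight-cut-[] zero    k = refl
  weight-cut-[] (suc r) k rewrite weight-cut-[] r (suc k) | weight-cut-[] r k = refl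

  -- Stated without subtraction. The front move contributes `2 ^ r`, the move at `k` the induction
  -- hypothesis, and the remaining sites a sum of binomials.
  weight-cut : ∀ r k ks → weight r (cut k ks) + suc r ≡ 2 ^ r + binomial r (suc (length ks))
  weight-cut zero    k ks = refl
  weight-cut (suc r) k ks
    rewrite weight-siteMoves r (binomial r) (λ j js → weight-uncut r (j ∷ js)) ks
          | weight-cut-[] r (suc k) | binomial-0 r = begin
      p + (y + s) + suc (suc r)  ≡⟨ regroup₁ p y s r ⟩
      p + (y + suc r) + suc s    ≡⟨ cong (λ z → p + z + suc s) (weight-cut r k ks) ⟩
      p + (p + q) + suc s        ≡⟨ regroup₂ p q s ⟩
      2 * p + (1 + (q + s))      ∎
    where
    open ≡-Reasoning
    p = 2 ^ r
    q = binomial r (suc (length ks))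
    y = weight r (cut k ks)
    s = sum₁ (binomial r) (length ks)
    regroup₁ : ∀ p y s r → p + (y + s) + suc (suc r) ≡ p + (y + suc r) + suc s
    regroup₁ = solve-∀
    regroup₂ : ∀ p q s → p + (p + q) + suc s ≡ 2 * p + (1 + (q + s))
    regroup₂ = solve-∀

  -- `weight-cut` summed over the nonempty suffixes of `js`. The `1` on the left supplies the term
  -- at `0` missing from the hockey-stick sum of binomials.
  weight-cuts : ∀ r js → sum (map (weight r ∘ proj₂) (siteMoves cut js)) + length js * suc r + 1 ≡
                         length js * 2 ^ r + binomial (suc r) (length js)
  weight-cuts r []       = sym (binomial-0 (suc r))
  weight-cuts r (j ∷ js) = begin
    x + s + (suc r + l * suc r) + 1      ≡⟨ regroup₁ x s (suc r) (l * suc r) ⟩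
    (x + suc r) + (s + l * suc r + 1)    ≡⟨ cong₂ _+_ (weight-cut r j js) (weight-cuts r js) ⟩
    (p + q) + (l * p + binomial (suc r) l) ≡⟨ regroup₂ p q (l * p) (binomial (suc r) l) ⟩
    p + l * p + (binomial (suc r) l + q) ≡⟨ cong (p + l * p +_) (pascal r l) ⟨
    p + l * p + binomial (suc r) (suc l) ∎
    where
    open ≡-Reasoning
    p = 2 ^ r
    l = length js
    q = binomial r (suc l)
    x = weight r (cut j js)
    s = sum (map (weight r ∘ proj₂) (siteMoves cut js))
    regroup₁ : ∀ x s a b → x + s + (a + b) + 1 ≡ (x + a) + (s + b + 1)
    regroup₁ = solve-∀
    regroup₂ : ∀ p q a b → (p + q) + (a + b) ≡ p + a + (b + q)
    regroup₂ = solve-∀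

  -- Σ_{k ≤ r} (r + m) choose k
  rowSum : ℕ → ℕ → ℕ
  rowSum zero    m = 1
  rowSum (suc r) m = rowSum r (suc m) + binomial (suc r) m

  -- Pascal's rule in each term of the partial row; the terms with lowered index form the first
  -- summand.
  rowSum-pascal : ∀ r m → rowSum (suc r) (suc m) ≡ rowSum r (suc m) + rowSum (suc r) m
  rowSum-pascal zero    m = cong suc (begin
    binomial 1 (suc m)              ≡⟨ pascal 0 m ⟩
    binomial 1 m + 1                ≡⟨ +-comm _ 1 ⟩
    1 + binomial 1 m                ∎)
    where open ≡-Reasoning
  rowSum-pascal (suc r) m
    rewrite rowSum-pascal r (suc m) | pascal (suc r) m =
      lemma (rowSum r (suc (suc m))) (rowSum (suc r) (suc m))
            (binomial (suc (suc r)) m) (binomial (suc r) (suc m))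
    where
    lemma : ∀ a b c d → a + b + (c + d) ≡ a + d + (b + c)
    lemma = solve-∀

  -- The left partial row lacks only the final `1` of its row, and a full row is twice the preceding
  -- one.
  rowSum-1 : ∀ r → suc (rowSum r 1) ≡ 2 * rowSum r 0
  rowSum-1 zero    = refl
  rowSum-1 (suc r) = begin
    suc (rowSum (suc r) 1)              ≡⟨ cong suc (rowSum-pascal r 0) ⟩
    suc (rowSum r 1) + rowSum (suc r) 0 ≡⟨ cong (_+ rowSum (suc r) 0) step ⟩
    rowSum (suc r) 0 + rowSum (suc r) 0 ≡⟨ cong (rowSum (suc r) 0 +_) (+-identityʳ _) ⟨
    2 * rowSum (suc r) 0                ∎
    where
    open ≡-Reasoning
    step : suc (rowSum r 1) ≡ rowSum (suc r) 0
    step = trans (+-comm 1 _) (cong (rowSum r 1 +_) (sym (binomial-0 (suc r))))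

  rowSum-0 : ∀ r → rowSum r 0 ≡ 2 ^ r
  rowSum-0 zero    = refl
  rowSum-0 (suc r) = begin
    rowSum r 1 + binomial (suc r) 0 ≡⟨ cong (rowSum r 1 +_) (binomial-0 (suc r)) ⟩
    rowSum r 1 + 1                  ≡⟨ +-comm _ 1 ⟩
    suc (rowSum r 1)                ≡⟨ rowSum-1 r ⟩
    2 * rowSum r 0                  ≡⟨ cong (2 *_) (rowSum-0 r) ⟩
    2 * 2 ^ r                       ∎
    where open ≡-Reasoning

  -- General `m` is needed because the front insertion raises it. The other moves are summed by
  -- `weight-cuts`, and Pascal's rule matches the correction terms.
  weight-descending : ∀ r m →
    weight r (descending m) + (2 * r + suc m + m * (suc r C 2) + (suc r C 3)) ≡
    rowSum r m + suc m * 2 ^ r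
  weight-descending zero    m = lemma m
    where
    lemma : ∀ m → 1 + (suc m + m * 0 + 0) ≡ 1 + suc m * 1
    lemma = solve-∀
  weight-descending (suc r) m = begin
    a + s + (2 * suc r + suc m + m * (suc (suc r) C 2) + (suc (suc r) C 3))
      ≡⟨ cong₂ (λ t u → a + s + (2 * suc r + suc m + m * t + u))
           (trans (sym (nCk+nC[k+1]≡[n+1]C[k+1] (suc r) 1)) (cong (_+ t) (nC1≡n (suc r))))
           (sym (nCk+nC[k+1]≡[n+1]C[k+1] (suc r) 2)) ⟩
    a + s + (2 * suc r + suc m + m * (suc r + t) + (t + u))
      ≡⟨ regroup₁ a s r m t u ⟩
    (a + (2 * r + suc (suc m) + suc m * t + u)) + (s + m * suc r + 1)
      ≡⟨ cong₂ _+_ (weight-descending r (suc m)) cut-weights ⟩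
    (rowSum r (suc m) + suc (suc m) * p) + (m * p + binomial (suc r) m)
      ≡⟨ regroup₂ (rowSum r (suc m)) (binomial (suc r) m) m p ⟩
    rowSum r (suc m) + binomial (suc r) m + suc m * (2 * p) ∎
    where
    open ≡-Reasoning
    a = weight r (descending (suc m))
    s = sum (map (weight r ∘ proj₂) (siteMoves cut (applyDownFrom suc m)))
    t = suc r C 2
    u = suc r C 3
    p = 2 ^ r
    cut-weights : s + m * suc r + 1 ≡ m * p + binomial (suc r) m
    cut-weights = subst (λ l → s + l * suc r + 1 ≡ l * p + binomial (suc r) l)
              (length-applyDownFrom suc m) (weight-cuts r (applyDownFrom suc m))
    regroup₁ : ∀ a s r m t u → a + s + (2 * suc r + suc m + m * (suc r + t) + (t + u)) ≡
               (a + (2 * r + suc (suc m) + suc m * t + u)) + (s + m * suc r + 1)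
    regroup₁ = solve-∀
    regroup₂ : ∀ x b m p → (x + suc (suc m) * p) + (m * p + b) ≡ x + b + suc m * (2 * p)
    regroup₂ = solve-∀

  -- At the root the partial row is a full one, `2 ^ m`, and joins the other `2 ^ m` to make
  -- `2 ^ suc m`.
  weight-root : ∀ m → weight m (descending 0) + 2 * suc m + (suc m C 3) ≡ 2 ^ suc m + 1
  weight-root m = begin
    w + 2 * suc m + u                    ≡⟨ regroup₁ w m (suc m C 2) u ⟩
    (w + (2 * m + 1 + 0 * (suc m C 2) + u)) + 1 ≡⟨ cong (_+ 1) (weight-descending m 0) ⟩
    rowSum m 0 + 1 * 2 ^ m + 1           ≡⟨ cong (λ x → x + 1 * 2 ^ m + 1) (rowSum-0 m) ⟩
    2 ^ suc m + 1                        ∎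
    where
    open ≡-Reasoning
    w = weight m (descending 0)
    u = suc m C 3
    regroup₁ : ∀ w m t u → w + 2 * suc m + u ≡ (w + (2 * m + 1 + 0 * t + u)) + 1
    regroup₁ = solve-∀

  sum-map-concatMap : ∀ {A B : Set} (f : B → ℕ) (g : A → List B) xs →
                      sum (map f (concatMap g xs)) ≡ sum (map (λ x → sum (map f (g x))) xs)
  sum-map-concatMap f g []       = refl
  sum-map-concatMap f g (x ∷ xs) = begin
    sum (map f (g x ++ concatMap g xs))           ≡⟨ cong sum (map-++ f (g x) _) ⟩
    sum (map f (g x) ++ map f (concatMap g xs))   ≡⟨ sum-++ (map f (g x)) _ ⟩
    sum (map f (g x)) + sum (map f (concatMap g xs))
      ≡⟨ cong (sum (map f (g x)) +_) (sum-map-concatMap f g xs) ⟩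
    sum (map f (g x)) + sum (map (λ x → sum (map f (g x))) xs) ∎
    where open ≡-Reasoning

  sum-map-1 : ∀ {A : Set} (xs : List A) → sum (map (λ _ → 1) xs) ≡ length xs
  sum-map-1 []       = refl
  sum-map-1 (x ∷ xs) = cong suc (sum-map-1 xs)

  -- Descending one level trades a generation of `r` for one of `m`; at `r = 0` the left side counts
  -- the nodes of the level.
  levelWeight : ∀ r m → sum (map (weight r ∘ proj₂) (level m)) ≡ weight (m + r) (descending 0)
  levelWeight r zero    = +-identityʳ _
  levelWeight r (suc m) = begin
    sum (map (weight r ∘ proj₂) (concatMap (children (2 + m)) (level m)))
      ≡⟨ sum-map-concatMap _ (children (2 + m)) (level m) ⟩
    sum (map (λ n → sum (map (weight r ∘ proj₂) (children (2 + m) n))) (level m))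
      ≡⟨ cong sum (map-cong (λ (w , s) → cong sum (sym (map-∘ (moves s)))) (level m)) ⟩
    sum (map (weight (suc r) ∘ proj₂) (level m))  ≡⟨ levelWeight (suc r) m ⟩
    weight (m + suc r) (descending 0)             ≡⟨ cong (λ k → weight k (descending 0)) (+-suc m r) ⟩
    weight (suc m + r) (descending 0)             ∎
    where open ≡-Reasoning

  length-level : ∀ m → length (level m) ≡ weight m (descending 0)
  length-level m = begin
    length (level m)                          ≡⟨ sum-map-1 (level m) ⟨
    sum (map (weight 0 ∘ proj₂) (level m))    ≡⟨ levelWeight 0 m ⟩
    weight (m + 0) (descending 0)             ≡⟨ cong (λ k → weight k (descending 0)) (+-identityʳ m) ⟩
    weight m (descending 0)                   ∎
    where open ≡-Reasoning

-- The formula over the integers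

open import Data.Integer.Base using (+_; _+_; _-_)
import Data.Integer.Tactic.RingSolver as ℤ

≡-minus : ∀ N p q r → N ℕ.+ q ℕ.+ r ≡ p ℕ.+ 1 → + N ≡ + p + + 1 - + q - + r
≡-minus N p q r eq = begin
  + N                          ≡⟨ cancel (+ N) (+ q) (+ r) ⟩
  -- Sums of nonnegative integers compute to sums of naturals, so `eq` applies without conversion.
  + N + + q + + r - + q - + r  ≡⟨ cong (λ x → + x - + q - + r) eq ⟩
  + p + + 1 - + q - + r        ∎
  where
  open ≡-Reasoning
  cancel : ∀ x y z → x ≡ x + y + z - y - z
  cancel = ℤ.solve-∀

theorem3 : (n : ℕ) .{{_ : NonZero n}} →
    ∃[ N ] (HasCardinality (Avoiders n (1 ∷ 2 ∷ 3 ∷ 4 ∷ [])) N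
    × + N ≡ + (2 ^ n) + + 1 - + (2 * n) - + (n C 3))
theorem3 (suc m) =
  length (level m) , avoiders-cardinality m ,
  ≡-minus (length (level m)) (2 ^ suc m) (2 * suc m) (suc m C 3)
    (trans (cong (λ N → N ℕ.+ 2 * suc m ℕ.+ (suc m C 3)) (length-level m)) (weight-root m))
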